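{- If $(i,j)$ and $(i',j')$ are both winning bites of the same bar and $i<i'$, then $j>j'$. Moreover no winning bite of an $a\times b$ bar with $a\ge2$, $ab\ge2$ lies in row $1$; by the transposition symmetry of the game, none lies in column $1$. Consequently the winning bites form a strict antichain in the product order, there is at most one in each row and each column, and at most $\min(a-1,b-1)$ in total.
   Context: Chomp on the $a\times b$ bar: the board consists of the cells $(r,c)$ with $1\le r\le a$, $1\le c\le b$ (rows indexed downward). Two players alternate. A move (bite) at a remaining cell $(i,j)$ removes every remaining cell $(r,c)$ with $r\ge i$ and $c\ge j$. The player forced to take the poisoned cell $(1,1)$ loses. A position is a $P$-position if the player to move loses under optimal play. A winning bite of the bar is an opening move (a bite of the full bar) that leaves a $P$-position for the opponent. In the paper, "strict antichain in the product order" refers to the first assertion: of two distinct winning bites, the one in the lower-numbered row lies in the higher-numbered column. The transposition symmetry is the fact that transposing the board preserves $P$-positions and puts the winning bites of the $a\times b$ bar in bijection with those of the $b\times a$ bar.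
   Formalization: The column-1 exclusion is stated for b≥2, and the bound min(a-1,b-1) for a≥2 and b≥2: on an a×1 bar with a≥2 the bite (2,1) is winning, lies in column 1, and exceeds the bound 0 (likewise 1×b with b≥2 for the bound). -}

module Defs where

open import Data.List.Base using (List; applyUpTo; cartesianProduct; filter)
open import Data.List.Membership.Propositional using (_∈_; _∉_)
open import Data.Nat.Base using (ℕ; suc; _≤_; _<_; _>_)
open import Data.Nat.Properties using (_≤?_)
open import Data.Product.Base using (_×_; _,_; proj₁; proj₂)
open import Data.Product.Relation.Binary.Pointwise.NonDependent
  using (Pointwise; ×-decidable)
open import Data.Sum.Base using (_⊎_)
open import Level using (0ℓ)
open import Relation.Binary.Core using (Rel)
open import Relation.Binary.Definitions using (Decidable)
open import Relation.Binary.PropositionalEquality.Core using (_≢_)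
open import Relation.Nullary.Decidable using (¬?)
open import Relation.Unary using (Pred)

-- (row , column), both numbered from 1.
Cell : Set
Cell = ℕ × ℕ

poison : Cell
poison = 1 , 1

infix 4 _≼_ _≼?_

_≼_ : Rel Cell 0ℓ
_≼_ = Pointwise _≤_ _≤_

_≼?_ : Decidable _≼_
_≼?_ = ×-decidable _≤?_ _≤?_

-- A position is the list of the remaining cells.
Position : Set
Position = List Cell

bar : ℕ → ℕ → Position
bar a b = cartesianProduct (applyUpTo suc a) (applyUpTo suc b)

bite : Cell → Position → Position
bite x = filter (λ y → ¬? (x ≼? y))

-- Whoever takes the poisoned cell loses, so once it is gone the player to
-- move (the opponent of the player who took it) has won.  Play is finite, so
-- the inductive reading of "wins" and "loses" is the usual one.
mutual
  data NPosition (X : Position) : Set where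
    poisonTaken : poison ∉ X → NPosition X
    goodBite    : ∀ {x} → x ∈ X → PPosition (bite x X) → NPosition X

  data PPosition (X : Position) : Set where
    allBitesBad : poison ∈ X → (∀ {x} → x ∈ X → NPosition (bite x X)) →
                  PPosition X

WinningBite : ℕ → ℕ → Pred Cell 0ℓ
WinningBite a b x = x ∈ bar a b × PPosition (bite x (bar a b))

-- Of two distinct elements, the one in the lower-numbered row lies in the
-- higher-numbered column; in particular the two are incomparable under _≼_.
StrictAntichain : Pred Cell 0ℓ → Set
StrictAntichain S = ∀ {x y} → S x → S y → x ≢ y →
  (proj₁ x < proj₁ y × proj₂ x > proj₂ y) ⊎
  (proj₁ y < proj₁ x × proj₂ y > proj₂ x)

{-# OPTIONS --safe #-}
module Submission where

-- Biting x after y, where x ≼ y, has the same effect as biting x alone.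
--
-- Comparable winning bites are therefore equal: if x and y were distinct
-- winning bites with x ≼ y, then after y the cell x would still be there, and
-- biting it would leave the P-position reached by biting x at once.  So the
-- position after y would have a bite to a P-position, and would not be a
-- P-position (comparable⇒≡).  The order statements all follow from this.
--
-- A position whose cells have a greatest element c other than the poisoned
-- cell is never a P-position, by strategy stealing: any winning reply x to the
-- bite c satisfies x ≼ c, so playing x instead of c already reaches the same
-- P-position (greatest⇒¬PPosition).  A bite in the first row leaves nothing or
-- a smaller bar of the same height, whose corner is such a c once there are at
-- least two rows; likewise for the first column.
--
-- For the count, winning bites have distinct rows and distinct columns, the
-- rows lie in 2, ..., a, and the columns in 2, ..., b.

open import Defs
open import Data.Bool.Base using (true; false)
open import Data.Fin.Base using (Fin; zero; suc; fromℕ<)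
open import Data.Fin.Properties using (injective⇒≤; fromℕ<-injective)
open import Data.List.Base using (List; []; _∷_; length; lookup; filter; applyUpTo)
open import Data.List.Membership.Propositional using (_∈_)
open import Data.List.Membership.Propositional.Properties
  using (∈-applyUpTo⁺; ∈-applyUpTo⁻; ∈-cartesianProduct⁺; ∈-cartesianProduct⁻;
         ∈-filter⁺; ∈-filter⁻; ∈-lookup)
open import Data.List.Properties using (filter-reject)
open import Data.List.Relation.Unary.All as All using (All)
open import Data.List.Relation.Unary.AllPairs using (_∷_)
open import Data.List.Relation.Unary.Unique.Propositional using (Unique)
open import Data.Nat.Base
  using (ℕ; zero; suc; _≤_; _<_; _>_; _*_; _∸_; _⊓_; z≤n; s≤s)
open import Data.Nat.Properties
  using (≤-refl; ≤-trans; ≤-antisym; ≤-total; ≤∧≢⇒<; n≤1+n; 1+n≰n; <-cmp;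
         <-irrefl; ≰⇒>; ≮⇒≥; ⊓-glb; ∸-monoˡ-<; ∸-cancelʳ-≡)
open import Data.Product.Base using (_×_; _,_; proj₁; proj₂)
open import Data.Product.Relation.Binary.Pointwise.NonDependent
  using (×-transitive; ×-antisymmetric; ≡×≡⇒≡)
open import Data.Sum.Base using (inj₁; inj₂)
open import Function.Base using (_∘_)
open import Level using (Level)
open import Relation.Binary.Definitions using (tri<; tri≈; tri>)
open import Relation.Binary.PropositionalEquality.Core
  using (_≡_; refl; sym; trans; cong; subst)
open import Relation.Nullary.Decidable.Core using (does; yes; no)
open import Relation.Nullary.Negation.Core using (¬_; contradiction)
open import Relation.Unary as Unary using (Pred)

private
  variable
    ℓ p q : Level
    A : Set ℓ

filter-absorb : {P : Pred A p} {Q : Pred A q}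
                (P? : Unary.Decidable P) (Q? : Unary.Decidable Q) →
                P Unary.⊆ Q →
                ∀ xs → filter P? (filter Q? xs) ≡ filter P? xs
filter-absorb P? Q? P⊆Q []       = refl
filter-absorb P? Q? P⊆Q (x ∷ xs) with ih ← filter-absorb P? Q? P⊆Q xs | Q? x
... | no ¬Qx = trans ih (sym (filter-reject P? (¬Qx ∘ P⊆Q)))
... | yes _ with does (P? x)
...   | true  = cong (x ∷_) ih
...   | false = ih

lookup-injective : {xs : List A} → Unique xs → ∀ {i j} →
                   lookup xs i ≡ lookup xs j → i ≡ j
lookup-injective (_   ∷ _  ) {zero}  {zero}  _  = refl
lookup-injective (x∉ ∷ _  ) {zero}  {suc j} eq =
  contradiction eq (All.lookup x∉ (∈-lookup j))
lookup-injective (x∉ ∷ _  ) {suc i} {zero}  eq =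
  contradiction (sym eq) (All.lookup x∉ (∈-lookup i))
lookup-injective (_   ∷ xs!) {suc i} {suc j} eq =
  cong suc (lookup-injective xs! eq)

-- The pigeonhole principle for a list without repetition, with f labelling its
-- elements by the holes l, l + 1, ..., u - 1.
length≤range : {S : Pred A p} (f : A → ℕ) (l u : ℕ) →
               (∀ {x} → S x → l ≤ f x × f x < u) →
               (∀ {x y} → S x → S y → f x ≡ f y → x ≡ y) →
               ∀ xs → Unique xs → All S xs → length xs ≤ u ∸ l
length≤range {S = S} f l u range f-inj xs xs! Sxs = injective⇒≤ {f = hole} hole-inj
  where
  S-lookup : ∀ i → S (lookup xs i)
  S-lookup i = All.lookup Sxs (∈-lookup i)

  l≤ : ∀ i → l ≤ f (lookup xs i)
  l≤ i = proj₁ (range (S-lookup i))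

  offset< : ∀ i → f (lookup xs i) ∸ l < u ∸ l
  offset< i = ∸-monoˡ-< (proj₂ (range (S-lookup i))) (l≤ i)

  hole : Fin (length xs) → Fin (u ∸ l)
  hole i = fromℕ< (offset< i)

  hole-inj : ∀ {i j} → hole i ≡ hole j → i ≡ j
  hole-inj {i} {j} eq = lookup-injective xs!
    (f-inj (S-lookup i) (S-lookup j)
      (∸-cancelʳ-≡ (l≤ i) (l≤ j)
        (fromℕ<-injective _ _ (offset< i) (offset< j) eq)))

≼-trans : ∀ {x y z} → x ≼ y → y ≼ z → x ≼ z
≼-trans = ×-transitive {R = _≤_} {S = _≤_} ≤-trans ≤-trans

≼-antisym : ∀ {x y} → x ≼ y → y ≼ x → x ≡ y
≼-antisym x≼y y≼x =
  ≡×≡⇒≡ (×-antisymmetric {R = _≤_} {S = _≤_} ≤-antisym ≤-antisym x≼y y≼x)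

∈-bite⁺ : ∀ {x y X} → y ∈ X → ¬ (x ≼ y) → y ∈ bite x X
∈-bite⁺ = ∈-filter⁺ _

∈-bite⁻ : ∀ {x y} X → y ∈ bite x X → y ∈ X × ¬ (x ≼ y)
∈-bite⁻ _ = ∈-filter⁻ _

bite-absorb : ∀ {x y} → x ≼ y → ∀ X → bite x (bite y X) ≡ bite x X
bite-absorb x≼y = filter-absorb _ _ λ x⋠z y≼z → x⋠z (≼-trans x≼y y≼z)

∈-bar⁺ : ∀ {a b i j} → 1 ≤ i → i ≤ a → 1 ≤ j → j ≤ b → (i , j) ∈ bar a b
∈-bar⁺ (s≤s _) i≤a (s≤s _) j≤b =
  ∈-cartesianProduct⁺ (∈-applyUpTo⁺ suc i≤a) (∈-applyUpTo⁺ suc j≤b)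

∈-bar⁻ : ∀ a b {i j} → (i , j) ∈ bar a b →
         (1 ≤ i × i ≤ a) × (1 ≤ j × j ≤ b)
∈-bar⁻ a b ij∈
  with i∈ , j∈ ← ∈-cartesianProduct⁻ (applyUpTo suc a) (applyUpTo suc b) ij∈
  with _ , i≤a , refl ← ∈-applyUpTo⁻ suc i∈
     | _ , j≤b , refl ← ∈-applyUpTo⁻ suc j∈
  = (s≤s z≤n , i≤a) , (s≤s z≤n , j≤b)

PPosition⇒poison∈ : ∀ {X} → PPosition X → poison ∈ X
PPosition⇒poison∈ (allBitesBad poison∈ _) = poison∈

PPosition⇒¬NPosition : ∀ {X} → PPosition X → ¬ NPosition X
PPosition⇒¬NPosition (allBitesBad poison∈ _) (poisonTaken poison∉) = poison∉ poison∈
PPosition⇒¬NPosition (allBitesBad _ bad)     (goodBite x∈ good)    =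
  PPosition⇒¬NPosition good (bad x∈)

comparable⇒≡ : ∀ {X x y} → x ∈ X → PPosition (bite x X) → PPosition (bite y X) →
               x ≼ y → x ≡ y
comparable⇒≡ {X} {x} {y} x∈ Px Py x≼y with y ≼? x
... | yes y≼x = ≼-antisym x≼y y≼x
... | no  y⋠x = contradiction
  (goodBite (∈-bite⁺ x∈ y⋠x) (subst PPosition (sym (bite-absorb x≼y X)) Px))
  (PPosition⇒¬NPosition Py)

-- Strategy stealing: in a P-position the bite c would have a winning reply,
-- which would itself be a winning first bite.
greatest⇒¬PPosition : ∀ {X c} → c ∈ X → (∀ {x} → x ∈ X → x ≼ c) → ¬ (c ≡ poison) →
                      ¬ PPosition X
greatest⇒¬PPosition {X} c∈ ≼c c≢ (allBitesBad poison∈ bad) with bad c∈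
... | poisonTaken poison∉ =
  poison∉ (∈-bite⁺ poison∈ λ c≼poison → c≢ (≼-antisym c≼poison (≼c poison∈)))
... | goodBite {x} x∈′ good = PPosition⇒¬NPosition
  (subst PPosition (bite-absorb (≼c x∈) X) good) (bad x∈)
  where
  x∈ : x ∈ X
  x∈ = proj₁ (∈-bite⁻ X x∈′)

module WinningBites (a b : ℕ) where

  winning-≼⇒≡ : ∀ {x y} → WinningBite a b x → WinningBite a b y → x ≼ y → x ≡ y
  winning-≼⇒≡ (x∈ , Px) (_ , Py) = comparable⇒≡ x∈ Px Py

  winning-antitone : ∀ {i j i′ j′} → WinningBite a b (i , j) →
                     WinningBite a b (i′ , j′) → i < i′ → j > j′
  winning-antitone w w′ i<i′ = ≰⇒> λ j≤j′ →
    <-irrefl (cong proj₁ (winning-≼⇒≡ w w′ (≤-trans (n≤1+n _) i<i′ , j≤j′))) i<i′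

  winning-row-unique : ∀ {i j j′} → WinningBite a b (i , j) →
                       WinningBite a b (i , j′) → j ≡ j′
  winning-row-unique {j = j} {j′} w w′ with ≤-total j j′
  ... | inj₁ j≤j′ = cong proj₂ (winning-≼⇒≡ w w′ (≤-refl , j≤j′))
  ... | inj₂ j′≤j = sym (cong proj₂ (winning-≼⇒≡ w′ w (≤-refl , j′≤j)))

  winning-column-unique : ∀ {i i′ j} → WinningBite a b (i , j) →
                          WinningBite a b (i′ , j) → i ≡ i′
  winning-column-unique {i} {i′} w w′ with ≤-total i i′
  ... | inj₁ i≤i′ = cong proj₁ (winning-≼⇒≡ w w′ (i≤i′ , ≤-refl))
  ... | inj₂ i′≤i = sym (cong proj₁ (winning-≼⇒≡ w′ w (i′≤i , ≤-refl)))

  winning-strictAntichain : StrictAntichain (WinningBite a b)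
  winning-strictAntichain {i , j} {i′ , j′} w w′ x≢y with <-cmp i i′
  ... | tri< i<i′ _ _ = inj₁ (i<i′ , winning-antitone w w′ i<i′)
  ... | tri≈ _ refl _ = contradiction (cong (i ,_) (winning-row-unique w w′)) x≢y
  ... | tri> _ _ i′<i = inj₂ (i′<i , winning-antitone w′ w i′<i)

  row-one-not-winning : 2 ≤ a → ∀ j → ¬ WinningBite a b (1 , j)
  row-one-not-winning 2≤a 0 (x∈ , _) with () ← proj₁ (proj₂ (∈-bar⁻ a b x∈))
  -- Biting (1 , 1) takes the poison.
  row-one-not-winning 2≤a 1 (_ , P) =
    proj₂ (∈-bite⁻ (bar a b) (PPosition⇒poison∈ P)) (≤-refl , ≤-refl)
  -- Otherwise the bite leaves the a × (1 + k) bar, with greatest cell (a , 1 + k).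
  row-one-not-winning 2≤a (suc (suc k)) (x∈ , P) =
    greatest⇒¬PPosition
      (∈-bite⁺ (∈-bar⁺ 1≤a ≤-refl (s≤s z≤n) (≤-trans (n≤1+n _) j≤b))
               (1+n≰n ∘ proj₂))
      (λ y∈′ → let y∈ , x⋠y = ∈-bite⁻ (bar a b) y∈′ ; (1≤r , r≤a) , _ = ∈-bar⁻ a b y∈ in
        r≤a , ≮⇒≥ (λ j≤s → x⋠y (1≤r , j≤s)))
      (λ { refl → 1+n≰n 2≤a })
      P
    where
    1≤a : 1 ≤ a
    1≤a = ≤-trans (n≤1+n 1) 2≤a

    j≤b : suc (suc k) ≤ b
    j≤b = proj₂ (proj₂ (∈-bar⁻ a b x∈))

  column-one-not-winning : 2 ≤ b → ∀ i → ¬ WinningBite a b (i , 1)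
  column-one-not-winning 2≤b 0 (x∈ , _) with () ← proj₁ (proj₁ (∈-bar⁻ a b x∈))
  column-one-not-winning 2≤b 1 (_ , P) =
    proj₂ (∈-bite⁻ (bar a b) (PPosition⇒poison∈ P)) (≤-refl , ≤-refl)
  -- Here the greatest remaining cell is (1 + k , b).
  column-one-not-winning 2≤b (suc (suc k)) (x∈ , P) =
    greatest⇒¬PPosition
      (∈-bite⁺ (∈-bar⁺ (s≤s z≤n) (≤-trans (n≤1+n _) i≤a) 1≤b ≤-refl)
               (1+n≰n ∘ proj₁))
      (λ y∈′ → let y∈ , x⋠y = ∈-bite⁻ (bar a b) y∈′ ; _ , (1≤s , s≤b) = ∈-bar⁻ a b y∈ in
        ≮⇒≥ (λ i≤r → x⋠y (i≤r , 1≤s)) , s≤b)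
      (λ { refl → 1+n≰n 2≤b })
      P
    where
    1≤b : 1 ≤ b
    1≤b = ≤-trans (n≤1+n 1) 2≤b

    i≤a : suc (suc k) ≤ a
    i≤a = proj₂ (proj₁ (∈-bar⁻ a b x∈))

  winning-row-range : 2 ≤ a → ∀ {x} → WinningBite a b x →
                      2 ≤ proj₁ x × proj₁ x < suc a
  winning-row-range 2≤a {i , j} w@(x∈ , _) with (1≤i , i≤a) , _ ← ∈-bar⁻ a b x∈
    = ≤∧≢⇒< 1≤i (λ { refl → row-one-not-winning 2≤a j w }) , s≤s i≤a

  winning-column-range : 2 ≤ b → ∀ {x} → WinningBite a b x →
                         2 ≤ proj₂ x × proj₂ x < suc b
  winning-column-range 2≤b {i , j} w@(x∈ , _) with _ , (1≤j , j≤b) ← ∈-bar⁻ a b x∈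
    = ≤∧≢⇒< 1≤j (λ { refl → column-one-not-winning 2≤b i w }) , s≤s j≤b

  winning-count : 2 ≤ a → 2 ≤ b → ∀ ws → Unique ws → All (WinningBite a b) ws →
                  length ws ≤ (a ∸ 1) ⊓ (b ∸ 1)
  winning-count 2≤a 2≤b ws ws! W = ⊓-glb
    (length≤range {S = WinningBite a b} proj₁ 2 (suc a) (winning-row-range 2≤a)
      (λ { w w′ refl → cong (_ ,_) (winning-row-unique w w′) }) ws ws! W)
    (length≤range {S = WinningBite a b} proj₂ 2 (suc b) (winning-column-range 2≤b)
      (λ { w w′ refl → cong (_, _) (winning-column-unique w w′) }) ws ws! W)

theorem4p1 : ∀ (a b : ℕ) → 1 ≤ a → 1 ≤ b →
    (∀ {i j i′ j′} → WinningBite a b (i , j) → WinningBite a b (i′ , j′) → i < i′ → j > j′)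
    × (2 ≤ a → 2 ≤ a * b → ∀ j → ¬ WinningBite a b (1 , j))
    × (2 ≤ b → 2 ≤ a * b → ∀ i → ¬ WinningBite a b (i , 1))
    × StrictAntichain (WinningBite a b)
    × (∀ {i j j′} → WinningBite a b (i , j) → WinningBite a b (i , j′) → j ≡ j′)
    × (∀ {i i′ j} → WinningBite a b (i , j) → WinningBite a b (i′ , j) → i ≡ i′)
    × (2 ≤ a → 2 ≤ b → ∀ (ws : List Cell) → Unique ws → All (WinningBite a b) ws → length ws ≤ (a ∸ 1) ⊓ (b ∸ 1))
theorem4p1 a b _ _ =
    winning-antitone
  , (λ 2≤a _ → row-one-not-winning 2≤a)
  , (λ 2≤b _ → column-one-not-winning 2≤b)
  , winning-strictAntichain
  , winning-row-unique
  , winning-column-unique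
  , winning-count
  where open WinningBites a b
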